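{- If $\Gamma\vdash M:A$ is derivable in $\lambda\mathbf A$ and $M\to_\beta L$, then $\Gamma\vdash L:A$ is derivable in $\lambda\mathbf A$.
   Context: $\to_\beta$ is one-step $\beta$-reduction of untyped $\lambda$-terms (contracting a redex $(\lambda x.M)N$ to $M[N/x]$ in any context). Type expressions. Pseudo type expressions: $A::=X\mid A\to B\mid\bullet A\mid\mu X.A$ ($\alpha$-equivalent ones identified; $A[B/X]$ capture-avoiding substitution). $\top:=\mu X.\bullet X$. Tail: $t(X)=X$, $t(A\to B)=t(B)$, $t(\bullet A)=\bullet t(A)$, $t(\mu X.A)=\mu X.t(A)$. $A$ is a $\top$-variant iff $t(A)=\bullet^{m_0}\mu X_1.\bullet^{m_1}\cdots\mu X_n.\bullet^{m_n}X_i$ with $1\le i\le n$, $X_i\notin\{X_{i+1},\dots,X_n\}$, $m_i+\dots+m_n\ge1$. Properness in $X$: variable $Y$ iff $Y\ne X$; $\bullet A$ always; $A\to B$ iff both are or $B$ is a $\top$-variant; $\mu Y.A$ ($Y\ne X$) iff $A$ is or $\mu Y.A$ is a $\top$-variant. Type expressions: every $\mu X.A$ has $A$ proper in $X$. Equality $\simeq$: smallest relation closed under reflexivity, symmetry, transitivity, $\bullet$- and $\to$-congruence, $A\to\top\simeq\top$, $\mu X.A\simeq A[\mu X.A/X]$, ($A\simeq C[A/X]$, $C$ proper in $X$) $\Rightarrow A\simeq\mu X.C$, and $\bullet(A\to B)\simeq\bullet A\to\bullet B$. $A\preceq B$ means $\emptyset\vdash A\preceq B$ is derivable, where $\gamma$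 ranges over finite sets of pairs $X\preceq Y$ of type variables each occurring at most once, by: $\gamma\cup\{X\preceq Y\}\vdash X\preceq Y$; $\gamma\vdash A\preceq\top$; $A\simeq B\Rightarrow\gamma\vdash A\preceq B$; transitivity (union of assumptions); $\gamma\vdash A\preceq B\Rightarrow\gamma\vdash\bullet A\preceq\bullet B$; $\gamma_1\vdash A'\preceq A$, $\gamma_2\vdash B\preceq B'\Rightarrow\gamma_1\cup\gamma_2\vdash A\to B\preceq A'\to B'$; $\gamma\cup\{X\preceq Y\}\vdash A\preceq B\Rightarrow\gamma\vdash\mu X.A\preceq\mu Y.B$ if $X$ not free in $\gamma,B$, $Y$ not free in $\gamma,A$, $A$ proper in $X$, $B$ proper in $Y$; $\gamma\vdash A\preceq\bullet A$. Typing system $\lambda\mathbf A$: typing contexts are finite maps from individual variables to type expressions; $\bullet\Gamma$ maps $x\mapsto\bullet\Gamma(x)$; unions of contexts must agree on common variables. Rules: $\Gamma\cup\{x:A\}\vdash x:A$; from $\bullet\Gamma\vdash M:\bullet A$ infer $\Gamma\vdash M:A$; $\Gamma\vdash M:\top$; from $\Gamma\vdash M:A$ and $A\preceq B$ infer $\Gamma\vdash M:B$; from $\Gamma\cup\{x:A\}\vdash M:B$ infer $\Gamma\vdash\lambda x.M:A\to B$; from $\Gamma_1\vdash M:A\to B$ and $\Gamma_2\vdash N:A$ infer $\Gamma_1\cup\Gamma_2\vdash MN:B$. -}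

module Defs where

open import Data.Nat using (ℕ; zero; suc)
open import Data.Bool using (Bool; true; false; T)
open import Data.List using (List; []; _∷_; map)
open import Data.Maybe using (Maybe; just; nothing) renaming (map to mapMaybe)
open import Data.Product using (_×_; _,_)
open import Data.Sum using (_⊎_)
open import Data.Unit using () renaming (⊤ to Unit)
open import Data.Empty using (⊥)
open import Relation.Binary.PropositionalEquality using (_≡_; _≢_)
open import Data.List.Membership.Propositional using (_∈_)
open import Function.Bundles using (_⇔_)

data Tm : Set where
  var : ℕ → Tm
  ƛ   : Tm → Tm
  _·_ : Tm → Tm → Tm

ext : (ℕ → ℕ) → ℕ → ℕ
ext ρ zero    = zero
ext ρ (suc n) = suc (ρ n)

renTm : (ℕ → ℕ) → Tm → Tm
renTm ρ (var n) = var (ρ n)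
renTm ρ (ƛ M)   = ƛ (renTm (ext ρ) M)
renTm ρ (M · N) = renTm ρ M · renTm ρ N

extsTm : (ℕ → Tm) → ℕ → Tm
extsTm σ zero    = var zero
extsTm σ (suc n) = renTm suc (σ n)

subTm : (ℕ → Tm) → Tm → Tm
subTm σ (var n) = σ n
subTm σ (ƛ M)   = ƛ (subTm (extsTm σ) M)
subTm σ (M · N) = subTm σ M · subTm σ N

sub0Tm : Tm → ℕ → Tm
sub0Tm N zero    = N
sub0Tm N (suc n) = var n

_[_] : Tm → Tm → Tm
M [ N ] = subTm (sub0Tm N) M

infix 4 _→β_
data _→β_ : Tm → Tm → Set where
  β    : ∀ {M N} → (ƛ M) · N →β M [ N ]
  ξ-ƛ  : ∀ {M M′} → M →β M′ → ƛ M →β ƛ M′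
  ξ-·ₗ : ∀ {M M′ N} → M →β M′ → M · N →β M′ · N
  ξ-·ᵣ : ∀ {M N N′} → N →β N′ → M · N →β M · N′

infixr 7 _⇒_
data Ty : Set where
  tvar : ℕ → Ty
  _⇒_  : Ty → Ty → Ty
  ●    : Ty → Ty
  μ    : Ty → Ty

renTy : (ℕ → ℕ) → Ty → Ty
renTy ρ (tvar n) = tvar (ρ n)
renTy ρ (A ⇒ B)  = renTy ρ A ⇒ renTy ρ B
renTy ρ (● A)    = ● (renTy ρ A)
renTy ρ (μ A)    = μ (renTy (ext ρ) A)

extsTy : (ℕ → Ty) → ℕ → Ty
extsTy σ zero    = tvar zero
extsTy σ (suc n) = renTy suc (σ n)

subTy : (ℕ → Ty) → Ty → Ty
subTy σ (tvar n) = σ n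
subTy σ (A ⇒ B)  = subTy σ A ⇒ subTy σ B
subTy σ (● A)    = ● (subTy σ A)
subTy σ (μ A)    = μ (subTy (extsTy σ) A)

sub0Ty : Ty → ℕ → Ty
sub0Ty B zero    = B
sub0Ty B (suc n) = tvar n

_[_]ᵀ : Ty → Ty → Ty
A [ B ]ᵀ = subTy (sub0Ty B) A

⊤ᵀ : Ty
⊤ᵀ = μ (● (tvar zero))

tl : Ty → Ty
tl (tvar n) = tvar n
tl (A ⇒ B)  = tl B
tl (● A)    = ● (tl A)
tl (μ A)    = μ (tl A)

-- ⊤-variants.  TVwalk L A walks through •^{m0} μ •^{m1} ... ; the list L
-- records, for each enclosing μ (innermost first), whether a • has
-- occurred since that μ.  The final variable must be bound by one of the
-- μ's (de Bruijn index j < length L; this is X_i ∉ {X_{i+1},…,X_n}) and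
-- some • must occur after its binder (m_i + … + m_n ≥ 1).
at : List Bool → ℕ → Bool
at []      n       = false
at (b ∷ L) zero    = b
at (b ∷ L) (suc n) = at L n

TVwalk : List Bool → Ty → Set
TVwalk L (tvar j) = T (at L j)
TVwalk L (A ⇒ B)  = ⊥
TVwalk L (● A)    = TVwalk (map (λ _ → true) L) A
TVwalk L (μ A)    = TVwalk (false ∷ L) A

TopVariant : Ty → Set
TopVariant A = TVwalk [] (tl A)

Proper : ℕ → Ty → Set
Proper n (tvar m) = m ≢ n
Proper n (A ⇒ B)  = (Proper n A × Proper n B) ⊎ TopVariant B
Proper n (● A)    = Unit
Proper n (μ A)    = Proper (suc n) A ⊎ TopVariant (μ A)

WF : Ty → Set
WF (tvar n) = Unit
WF (A ⇒ B)  = WF A × WF B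
WF (● A)    = WF A
WF (μ A)    = Proper zero A × WF A

infix 4 _≃_
data _≃_ : Ty → Ty → Set where
  ≃-refl   : ∀ {A} → WF A → A ≃ A
  ≃-sym    : ∀ {A B} → A ≃ B → B ≃ A
  ≃-trans  : ∀ {A B C} → A ≃ B → B ≃ C → A ≃ C
  ≃-●      : ∀ {A B} → A ≃ B → ● A ≃ ● B
  ≃-⇒      : ∀ {A A′ B B′} → A ≃ A′ → B ≃ B′ → (A ⇒ B) ≃ (A′ ⇒ B′)
  ≃-⇒⊤     : ∀ {A} → WF A → (A ⇒ ⊤ᵀ) ≃ ⊤ᵀ
  ≃-fold   : ∀ {A} → WF (μ A) → μ A ≃ A [ μ A ]ᵀ
  ≃-unique : ∀ {A C} → A ≃ C [ A ]ᵀ → Proper zero C → WF C → A ≃ μ C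
  ≃-dist   : ∀ {A B} → WF A → WF B → ● (A ⇒ B) ≃ (● A ⇒ ● B)

-- finite sets of pairs X ⪯ Y of type variables, represented by lists
-- (only membership matters)
Assm : Set
Assm = List (ℕ × ℕ)

fstP : ℕ × ℕ → ℕ
fstP (x , y) = x

sndP : ℕ × ℕ → ℕ
sndP (x , y) = y

Valid : Assm → Set
Valid γ = ∀ {p q} → p ∈ γ → q ∈ γ →
  (fstP p ≢ sndP q) × (fstP p ≡ fstP q → p ≡ q) × (sndP p ≡ sndP q → p ≡ q)

IsUnion : Assm → Assm → Assm → Set
IsUnion γ₁ γ₂ γ = ∀ p → (p ∈ γ) ⇔ (p ∈ γ₁ ⊎ p ∈ γ₂)

shift2 : ℕ → ℕ
shift2 n = suc (suc n)

shiftPair : ℕ × ℕ → ℕ × ℕ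
shiftPair (x , y) = (shift2 x , shift2 y)

-- Going under μX (left) and μY (right) simultaneously: outer variables k are
-- moved to k+2, X becomes index 0 and Y becomes index 1 (distinct and fresh).
ρL : ℕ → ℕ
ρL zero    = zero
ρL (suc k) = shift2 k

ρR : ℕ → ℕ
ρR zero    = suc zero
ρR (suc k) = shift2 k

infix 3 _⊢_⪯_
data _⊢_⪯_ : Assm → Ty → Ty → Set where
  ⪯-assm  : ∀ {γ X Y} → Valid γ → (X , Y) ∈ γ → γ ⊢ tvar X ⪯ tvar Y
  ⪯-top   : ∀ {γ A} → Valid γ → WF A → γ ⊢ A ⪯ ⊤ᵀ
  ⪯-eq    : ∀ {γ A B} → Valid γ → A ≃ B → γ ⊢ A ⪯ B
  ⪯-trans : ∀ {γ γ₁ γ₂ A B C} → γ₁ ⊢ A ⪯ B → γ₂ ⊢ B ⪯ C →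
            IsUnion γ₁ γ₂ γ → Valid γ → γ ⊢ A ⪯ C
  ⪯-●     : ∀ {γ A B} → γ ⊢ A ⪯ B → γ ⊢ ● A ⪯ ● B
  ⪯-⇒     : ∀ {γ γ₁ γ₂ A A′ B B′} → γ₁ ⊢ A′ ⪯ A → γ₂ ⊢ B ⪯ B′ →
            IsUnion γ₁ γ₂ γ → Valid γ → γ ⊢ A ⇒ B ⪯ A′ ⇒ B′
  ⪯-μ     : ∀ {γ A B} →
            ((zero , suc zero) ∷ map shiftPair γ) ⊢ renTy ρL A ⪯ renTy ρR B →
            Proper zero A → Proper zero B → γ ⊢ μ A ⪯ μ B
  ⪯-●ʳ    : ∀ {γ A} → Valid γ → WF A → γ ⊢ A ⪯ ● A

infix 4 _⪯_
_⪯_ : Ty → Ty → Set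
A ⪯ B = [] ⊢ A ⪯ B

-- Typing contexts: finite maps from (de Bruijn) individual variables to
-- type expressions, represented as lists of optional types.

Ctx : Set
Ctx = List (Maybe Ty)

lookupC : Ctx → ℕ → Maybe Ty
lookupC []      n       = nothing
lookupC (a ∷ Γ) zero    = a
lookupC (a ∷ Γ) (suc n) = lookupC Γ n

●C : Ctx → Ctx
●C Γ = map (mapMaybe ●) Γ

WFC : Ctx → Set
WFC Γ = ∀ n A → lookupC Γ n ≡ just A → WF A

data UnionAt : Maybe Ty → Maybe Ty → Maybe Ty → Set where
  none  : UnionAt nothing nothing nothing
  left  : ∀ {A} → UnionAt (just A) nothing (just A)
  right : ∀ {A} → UnionAt nothing (just A) (just A)
  both  : ∀ {A} → UnionAt (just A) (just A) (just A)

CtxUnion : Ctx → Ctx → Ctx → Set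
CtxUnion Γ₁ Γ₂ Γ = ∀ n → UnionAt (lookupC Γ₁ n) (lookupC Γ₂ n) (lookupC Γ n)

infix 3 _⊢_∶_
data _⊢_∶_ : Ctx → Tm → Ty → Set where
  ty-var : ∀ {Γ x A} → WFC Γ → lookupC Γ x ≡ just A → Γ ⊢ var x ∶ A
  ty-●   : ∀ {Γ M A} → ●C Γ ⊢ M ∶ ● A → Γ ⊢ M ∶ A
  ty-⊤   : ∀ {Γ M} → WFC Γ → Γ ⊢ M ∶ ⊤ᵀ
  ty-⪯   : ∀ {Γ M A B} → Γ ⊢ M ∶ A → A ⪯ B → Γ ⊢ M ∶ B
  ty-ƛ   : ∀ {Γ M A B} → (just A ∷ Γ) ⊢ M ∶ B → Γ ⊢ ƛ M ∶ A ⇒ B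
  ty-·   : ∀ {Γ Γ₁ Γ₂ M N A B} → Γ₁ ⊢ M ∶ A ⇒ B → Γ₂ ⊢ N ∶ A →
           CtxUnion Γ₁ Γ₂ Γ → Γ ⊢ M · N ∶ B

{-# OPTIONS --safe #-}
module Submission where

-- Unfolding μ and pushing • through ⇒ brings a type to the form ⊤, •ⁿ X or
-- P ⇒ Q.  By induction on derivations, ≃ preserves this form and relates the
-- components of arrows.  The only delicate case is the uniqueness rule
-- A ≃ C[A] for A ≃ μX.C: if C has an arrow form the components are compared by
-- substituting into those of C, and if it is •ⁿ X then n ≥ 1 by properness, so
-- both sides are ⊤.  Hence no completeness theorem for ≃ with respect to
-- infinite trees is needed.  For subtyping, if P ⇒ Q ⪯ P′ ⇒ Q′ then Q′ is ⊤ or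
-- P′ ⪯ •ᵏ P and •ᵏ Q ⪯ Q′ for some k.  The delay k is absorbed in the typing
-- of an abstraction by passing from Γ, x : P ⊢ M : Q to •ᵏ Γ, x : •ᵏ P ⊢ M : •ᵏ Q
-- and then back to Γ, since Γ ⪯ •ᵏ Γ pointwise.

open import Defs
open import Data.Nat using (ℕ; zero; suc; _+_; _<_; z<s; s<s)
open import Data.Nat.Properties using (+-identityʳ; +-suc; suc-injective; m+1+n≢m; +-comm)
open import Data.Bool using (true; false; T)
open import Data.List using ([]; _∷_; map; length)
open import Data.List.Properties using (length-map)
open import Data.List.Membership.Propositional using (_∈_)
open import Data.List.Membership.Propositional.Properties using (∈-map⁺; ∈-map⁻)
open import Data.List.Relation.Unary.Any using (here; there)
open import Data.Maybe using (Maybe; just; nothing; _>>=_) renaming (map to mapMaybe)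
open import Data.Maybe.Properties using (just-injective)
open import Data.Product using (_×_; _,_; proj₁; proj₂; ∃-syntax; map₁; map₂)
open import Data.Product.Properties using (,-injectiveˡ; ,-injectiveʳ)
open import Data.Sum using (_⊎_; inj₁; inj₂; [_,_]′)
open import Data.Unit using (tt)
open import Function using (_∘_; id; mk⇔)
open import Function.Bundles using (Equivalence)
open import Relation.Nullary using (contradiction)
open import Relation.Binary.PropositionalEquality
  using (_≡_; _≢_; _≗_; refl; sym; trans; cong; cong₂; subst; subst₂)

-- Substitution algebra

exts-cong : ∀ {σ τ} → σ ≗ τ → extsTy σ ≗ extsTy τ
exts-cong e zero    = refl
exts-cong e (suc n) = cong (renTy suc) (e n)

sub-cong : ∀ {σ τ} → σ ≗ τ → subTy σ ≗ subTy τ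
sub-cong e (tvar n) = e n
sub-cong e (A ⇒ B)  = cong₂ _⇒_ (sub-cong e A) (sub-cong e B)
sub-cong e (● A)    = cong ● (sub-cong e A)
sub-cong e (μ A)    = cong μ (sub-cong (exts-cong e) A)

exts-tvar : ∀ ρ → extsTy (tvar ∘ ρ) ≗ tvar ∘ ext ρ
exts-tvar ρ zero    = refl
exts-tvar ρ (suc n) = refl

ren-as-sub : ∀ ρ → renTy ρ ≗ subTy (tvar ∘ ρ)
ren-as-sub ρ (tvar n) = refl
ren-as-sub ρ (A ⇒ B)  = cong₂ _⇒_ (ren-as-sub ρ A) (ren-as-sub ρ B)
ren-as-sub ρ (● A)    = cong ● (ren-as-sub ρ A)
ren-as-sub ρ (μ A)    =
  cong μ (trans (ren-as-sub (ext ρ) A) (sub-cong (sym ∘ exts-tvar ρ) A))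

sub-id : subTy tvar ≗ id
sub-id (tvar n) = refl
sub-id (A ⇒ B)  = cong₂ _⇒_ (sub-id A) (sub-id B)
sub-id (● A)    = cong ● (sub-id A)
sub-id (μ A)    = cong μ (trans (sub-cong exts-id A) (sub-id A))
  where
  exts-id : extsTy tvar ≗ tvar
  exts-id zero    = refl
  exts-id (suc n) = refl

sub-ren : ∀ σ ρ → subTy σ ∘ renTy ρ ≗ subTy (σ ∘ ρ)
sub-ren σ ρ (tvar n) = refl
sub-ren σ ρ (A ⇒ B)  = cong₂ _⇒_ (sub-ren σ ρ A) (sub-ren σ ρ B)
sub-ren σ ρ (● A)    = cong ● (sub-ren σ ρ A)
sub-ren σ ρ (μ A)    = cong μ (trans (sub-ren (extsTy σ) (ext ρ) A) (sub-cong exts-ext A))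
  where
  exts-ext : extsTy σ ∘ ext ρ ≗ extsTy (σ ∘ ρ)
  exts-ext zero    = refl
  exts-ext (suc n) = refl

ren-ren : ∀ ρ ρ′ → renTy ρ ∘ renTy ρ′ ≗ renTy (ρ ∘ ρ′)
ren-ren ρ ρ′ A =
  trans (ren-as-sub ρ (renTy ρ′ A)) (trans (sub-ren (tvar ∘ ρ) ρ′ A) (sym (ren-as-sub (ρ ∘ ρ′) A)))

ren-sub : ∀ ρ σ → renTy ρ ∘ subTy σ ≗ subTy (renTy ρ ∘ σ)
ren-sub ρ σ (tvar n) = refl
ren-sub ρ σ (A ⇒ B)  = cong₂ _⇒_ (ren-sub ρ σ A) (ren-sub ρ σ B)
ren-sub ρ σ (● A)    = cong ● (ren-sub ρ σ A)
ren-sub ρ σ (μ A)    = cong μ (trans (ren-sub (ext ρ) (extsTy σ) A) (sub-cong ext-exts A))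
  where
  ext-exts : renTy (ext ρ) ∘ extsTy σ ≗ extsTy (renTy ρ ∘ σ)
  ext-exts zero    = refl
  ext-exts (suc n) = trans (ren-ren (ext ρ) suc (σ n)) (sym (ren-ren suc ρ (σ n)))

sub-sub : ∀ σ τ → subTy σ ∘ subTy τ ≗ subTy (subTy σ ∘ τ)
sub-sub σ τ (tvar n) = refl
sub-sub σ τ (A ⇒ B)  = cong₂ _⇒_ (sub-sub σ τ A) (sub-sub σ τ B)
sub-sub σ τ (● A)    = cong ● (sub-sub σ τ A)
sub-sub σ τ (μ A)    =
  cong μ (trans (sub-sub (extsTy σ) (extsTy τ) A) (sub-cong exts-exts A))
  where
  exts-exts : subTy (extsTy σ) ∘ extsTy τ ≗ extsTy (subTy σ ∘ τ)
  exts-exts zero    = refl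
  exts-exts (suc n) = trans (sub-ren (extsTy σ) suc (τ n)) (sym (ren-sub suc σ (τ n)))

infixr 5 _▸_
_▸_ : Ty → (ℕ → Ty) → ℕ → Ty
(B ▸ σ) zero    = B
(B ▸ σ) (suc n) = σ n

exts-sub0 : ∀ σ A B → (subTy (extsTy σ) A) [ B ]ᵀ ≡ subTy (B ▸ σ) A
exts-sub0 σ A B = trans (sub-sub (sub0Ty B) (extsTy σ) A) (sub-cong pointwise A)
  where
  pointwise : subTy (sub0Ty B) ∘ extsTy σ ≗ B ▸ σ
  pointwise zero    = refl
  pointwise (suc n) = trans (sub-ren (sub0Ty B) suc (σ n)) (sub-id (σ n))

sub-sub0 : ∀ σ A B → subTy σ (A [ B ]ᵀ) ≡ (subTy (extsTy σ) A) [ subTy σ B ]ᵀ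
sub-sub0 σ A B = trans (sub-sub σ (sub0Ty B) A)
  (trans (sub-cong pointwise A) (sym (exts-sub0 σ A (subTy σ B))))
  where
  pointwise : subTy σ ∘ sub0Ty B ≗ subTy σ B ▸ σ
  pointwise zero    = refl
  pointwise (suc n) = refl

-- Well-formedness

at⇒< : ∀ L {j} → T (at L j) → j < length L
at⇒< (b ∷ L) {zero}  t = z<s
at⇒< (b ∷ L) {suc j} t = s<s (at⇒< L t)

-- A walk can end only in a variable bound by one of the binders recorded in `L`, so `σ` must fix
-- just these. For empty `L` the condition is vacuous, so ⊤-variants are closed under all
-- substitutions.
TVwalk-sub : ∀ L A {σ} → (∀ {j} → j < length L → σ j ≡ tvar j) →
             TVwalk L (tl A) → TVwalk L (tl (subTy σ A))
TVwalk-sub L (tvar j) fix w = subst (TVwalk L ∘ tl) (sym (fix (at⇒< L w))) w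
TVwalk-sub L (A ⇒ B)  fix w = TVwalk-sub L B fix w
TVwalk-sub L (● A)    fix w =
  TVwalk-sub (map (λ _ → true) L) A (λ {j} l → fix (subst (j <_) (length-map _ L) l)) w
TVwalk-sub L (μ A) {σ} fix w = TVwalk-sub (false ∷ L) A fix′ w
  where
  fix′ : ∀ {j} → j < suc (length L) → extsTy σ j ≡ tvar j
  fix′ {zero}  l       = refl
  fix′ {suc j} (s<s l) = cong (renTy suc) (fix l)

TopVariant-sub : ∀ A σ → TopVariant A → TopVariant (subTy σ A)
TopVariant-sub A σ = TVwalk-sub [] A (λ ())

TopVariant-ren : ∀ A ρ → TopVariant A → TopVariant (renTy ρ A)
TopVariant-ren A ρ t = subst TopVariant (sym (ren-as-sub ρ A)) (TopVariant-sub A (tvar ∘ ρ) t)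

Proper-ren : ∀ {n m ρ} A → (∀ {k} → k ≢ n → ρ k ≢ m) → Proper n A → Proper m (renTy ρ A)
Proper-ren (tvar k) h p              = h p
Proper-ren (A ⇒ B)  h (inj₁ (p , q)) = inj₁ (Proper-ren A h p , Proper-ren B h q)
Proper-ren (A ⇒ B)  h (inj₂ t)       = inj₂ (TopVariant-ren B _ t)
Proper-ren (● A)    h p              = tt
Proper-ren {n} {m} {ρ} (μ A) h (inj₁ p) = inj₁ (Proper-ren A h′ p)
  where
  h′ : ∀ {k} → k ≢ suc n → ext ρ k ≢ suc m
  h′ {zero}  k≢ ()
  h′ {suc k} k≢ e = h (k≢ ∘ cong suc) (suc-injective e)
Proper-ren (μ A)    h (inj₂ t)       = inj₂ (TopVariant-ren (μ A) _ t)

Proper-fresh : ∀ {m ρ} A → (∀ k → ρ k ≢ m) → Proper m (renTy ρ A)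
Proper-fresh (tvar k) h = h k
Proper-fresh (A ⇒ B)  h = inj₁ (Proper-fresh A h , Proper-fresh B h)
Proper-fresh (● A)    h = tt
Proper-fresh {m} {ρ} (μ A) h = inj₁ (Proper-fresh A h′)
  where
  h′ : ∀ k → ext ρ k ≢ suc m
  h′ zero    ()
  h′ (suc k) e = h k (suc-injective e)

Proper-sub : ∀ {n m σ} A → (∀ {k} → k ≢ n → Proper m (σ k)) → Proper n A → Proper m (subTy σ A)
Proper-sub (tvar k) h p              = h p
Proper-sub (A ⇒ B)  h (inj₁ (p , q)) = inj₁ (Proper-sub A h p , Proper-sub B h q)
Proper-sub (A ⇒ B)  h (inj₂ t)       = inj₂ (TopVariant-sub B _ t)
Proper-sub (● A)    h p              = tt
Proper-sub {n} {m} {σ} (μ A) h (inj₁ p) = inj₁ (Proper-sub A h′ p)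
  where
  h′ : ∀ {k} → k ≢ suc n → Proper (suc m) (extsTy σ k)
  h′ {zero}  k≢ ()
  h′ {suc k} k≢ = Proper-ren (σ k) (_∘ suc-injective) (h (k≢ ∘ cong suc))
Proper-sub (μ A)    h (inj₂ t)       = inj₂ (TopVariant-sub (μ A) _ t)

Proper-exts : ∀ σ A → Proper zero A → Proper zero (subTy (extsTy σ) A)
Proper-exts σ A = Proper-sub A h
  where
  h : ∀ {k} → k ≢ zero → Proper zero (extsTy σ k)
  h {zero}  k≢ = contradiction refl k≢
  h {suc k} k≢ = Proper-fresh (σ k) (λ _ ())

Proper-ext : ∀ ρ A → Proper zero A → Proper zero (renTy (ext ρ) A)
Proper-ext ρ A = Proper-ren A h
  where
  h : ∀ {k} → k ≢ zero → ext ρ k ≢ zero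
  h {zero}  k≢ = contradiction refl k≢
  h {suc k} k≢ ()

WF-ren : ∀ ρ A → WF A → WF (renTy ρ A)
WF-ren ρ (tvar n) w       = tt
WF-ren ρ (A ⇒ B)  (v , w) = WF-ren ρ A v , WF-ren ρ B w
WF-ren ρ (● A)    w       = WF-ren ρ A w
WF-ren ρ (μ A)    (p , w) = Proper-ext ρ A p , WF-ren (ext ρ) A w

WFSub : (ℕ → Ty) → Set
WFSub σ = ∀ n → WF (σ n)

WF-exts : ∀ {σ} → WFSub σ → WFSub (extsTy σ)
WF-exts w zero        = tt
WF-exts {σ} w (suc n) = WF-ren suc (σ n) (w n)

WF-▸ : ∀ {B σ} → WF B → WFSub σ → WFSub (B ▸ σ)
WF-▸ v w zero    = v
WF-▸ v w (suc n) = w n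

WF-sub0 : ∀ {B} → WF B → WFSub (sub0Ty B)
WF-sub0 v zero    = v
WF-sub0 v (suc n) = tt

WF-sub : ∀ {σ} A → WFSub σ → WF A → WF (subTy σ A)
WF-sub (tvar n) s w       = s n
WF-sub (A ⇒ B)  s (v , w) = WF-sub A s v , WF-sub B s w
WF-sub (● A)    s w       = WF-sub A s w
WF-sub {σ} (μ A) s (p , w) = Proper-exts σ A p , WF-sub A (WF-exts s) w

WF-⊤ : WF ⊤ᵀ
WF-⊤ = tt , tt

≃-wf : ∀ {A B} → A ≃ B → WF A × WF B
≃-wf (≃-refl w)       = w , w
≃-wf (≃-sym e)        = proj₂ (≃-wf e) , proj₁ (≃-wf e)
≃-wf (≃-trans e f)    = proj₁ (≃-wf e) , proj₂ (≃-wf f)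
≃-wf (≃-● e)          = ≃-wf e
≃-wf (≃-⇒ e f)        = (proj₁ (≃-wf e) , proj₁ (≃-wf f)) , (proj₂ (≃-wf e) , proj₂ (≃-wf f))
≃-wf (≃-⇒⊤ w)         = (w , WF-⊤) , WF-⊤
≃-wf (≃-fold {A} w)   = w , WF-sub A (WF-sub0 w) (proj₂ w)
≃-wf (≃-unique e p w) = proj₁ (≃-wf e) , (p , w)
≃-wf (≃-dist v w)     = (v , w) , (v , w)

-- Equality and substitution

≃-sub : ∀ {A B} σ → WFSub σ → A ≃ B → subTy σ A ≃ subTy σ B
≃-sub σ s (≃-refl {A} w)         = ≃-refl (WF-sub A s w)
≃-sub σ s (≃-sym e)              = ≃-sym (≃-sub σ s e)
≃-sub σ s (≃-trans e f)          = ≃-trans (≃-sub σ s e) (≃-sub σ s f)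
≃-sub σ s (≃-● e)                = ≃-● (≃-sub σ s e)
≃-sub σ s (≃-⇒ e f)              = ≃-⇒ (≃-sub σ s e) (≃-sub σ s f)
≃-sub σ s (≃-⇒⊤ {A} w)           = ≃-⇒⊤ (WF-sub A s w)
≃-sub σ s (≃-fold {A} w)         =
  subst (subTy σ (μ A) ≃_) (sym (sub-sub0 σ A (μ A))) (≃-fold (WF-sub (μ A) s w))
≃-sub σ s (≃-unique {A} {C} e p w) =
  ≃-unique (subst (subTy σ A ≃_) (sub-sub0 σ C A) (≃-sub σ s e))
           (Proper-exts σ C p) (WF-sub C (WF-exts s) w)
≃-sub σ s (≃-dist {A} {B} v w)   = ≃-dist (WF-sub A s v) (WF-sub B s w)

-- Equality has no congruence rule for `μ`; that case is derived here from folding and uniqueness.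
sub-≃ : ∀ {σ τ} C → (∀ n → σ n ≃ τ n) → WF C → subTy σ C ≃ subTy τ C
sub-≃ (tvar n) e w       = e n
sub-≃ (A ⇒ B)  e (v , w) = ≃-⇒ (sub-≃ A e v) (sub-≃ B e w)
sub-≃ (● A)    e w       = ≃-● (sub-≃ A e w)
sub-≃ {σ} {τ} (μ A) e (p , w) =
  -- After unfolding the left side, both bodies receive the same type `subTy σ (μ A)` for the bound
  -- variable, so they differ only as `σ` and `τ` do and the induction hypothesis for `A` applies.
  ≃-unique
    (≃-trans (≃-fold wμ)
      (subst₂ _≃_ (sym (exts-sub0 σ A _)) (sym (exts-sub0 τ A _)) (sub-≃ A e′ w)))
    (Proper-exts τ A p) (WF-sub A (WF-exts (proj₂ ∘ ≃-wf ∘ e)) w)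
  where
  wμ : WF (subTy σ (μ A))
  wμ = WF-sub (μ A) (proj₁ ∘ ≃-wf ∘ e) (p , w)
  e′ : ∀ n → (subTy σ (μ A) ▸ σ) n ≃ (subTy σ (μ A) ▸ τ) n
  e′ zero    = ≃-refl wμ
  e′ (suc n) = e n

sub0-≃ : ∀ {A B} C → A ≃ B → WF C → C [ A ]ᵀ ≃ C [ B ]ᵀ
sub0-≃ {A} {B} C e = sub-≃ C pointwise
  where
  pointwise : ∀ n → sub0Ty A n ≃ sub0Ty B n
  pointwise zero    = e
  pointwise (suc n) = ≃-refl tt

-- Tails

Tail : Set
Tail = Maybe (ℕ × ℕ)

map-nothing⁻¹ : ∀ {f : ℕ × ℕ → ℕ × ℕ} (t : Tail) → mapMaybe f t ≡ nothing → t ≡ nothing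
map-nothing⁻¹ nothing _ = refl

delay : ℕ → Tail → Tail
delay n = mapMaybe (map₁ (n +_))

unbind : Tail → Tail
unbind nothing            = nothing
unbind (just (n , zero))  = nothing
unbind (just (n , suc j)) = just (n , j)

-- just (n , j) if the infinite unfolding of the tail is •ⁿ Xⱼ, and nothing
-- if it is •^∞, that is ⊤ (the ill-formed μX.X also gets nothing).
tailOf : Ty → Tail
tailOf (tvar j) = just (0 , j)
tailOf (A ⇒ B)  = tailOf B
tailOf (● A)    = delay 1 (tailOf A)
tailOf (μ A)    = unbind (tailOf A)

tail-ren : ∀ ρ A → tailOf (renTy ρ A) ≡ mapMaybe (map₂ ρ) (tailOf A)
tail-ren ρ (tvar j) = refl
tail-ren ρ (A ⇒ B)  = tail-ren ρ B
tail-ren ρ (● A) rewrite tail-ren ρ A with tailOf A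
... | nothing      = refl
... | just (n , j) = refl
tail-ren ρ (μ A) rewrite tail-ren (ext ρ) A with tailOf A
... | nothing          = refl
... | just (n , zero)  = refl
... | just (n , suc j) = refl

unbind-weaken : ∀ n t → unbind (delay n (mapMaybe (map₂ suc) t)) ≡ delay n t
unbind-weaken n nothing        = refl
unbind-weaken n (just (m , j)) = refl

delay-suc : ∀ n t → delay 1 (delay n t) ≡ delay (suc n) t
delay-suc n nothing        = refl
delay-suc n (just (m , j)) = refl

-- A substitution affects a tail only at its final variable: the `n` bullets in front of it are
-- added to the tail of `σ j`.
tail-sub : ∀ σ A → tailOf (subTy σ A) ≡ (tailOf A >>= λ (n , j) → delay n (tailOf (σ j)))
tail-sub σ (tvar j) with tailOf (σ j)
... | nothing = refl
... | just _  = refl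
tail-sub σ (A ⇒ B) = tail-sub σ B
tail-sub σ (● A) rewrite tail-sub σ A with tailOf A
... | nothing      = refl
... | just (n , j) = delay-suc n (tailOf (σ j))
tail-sub σ (μ A) rewrite tail-sub (extsTy σ) A with tailOf A
... | nothing          = refl
... | just (n , zero)  = refl
... | just (n , suc j) rewrite tail-ren suc (σ j) = unbind-weaken n (tailOf (σ j))

-- Each `μ` on the path adds one entry to `L`, so the final variable of a successful walk stays
-- bound. For empty `L` this leaves no final variable, and the tail of a ⊤-variant is `nothing`.
TVwalk⇒tail : ∀ L A {n j} → TVwalk L (tl A) → tailOf A ≡ just (n , j) → j < length L
TVwalk⇒tail L (tvar j) w refl = at⇒< L w
TVwalk⇒tail L (A ⇒ B)  w e    = TVwalk⇒tail L B w e
TVwalk⇒tail L (● A)    w e with tailOf A in eq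
TVwalk⇒tail L (● A) {j = j} w refl | just _ =
  subst (j <_) (length-map _ L) (TVwalk⇒tail (map (λ _ → true) L) A w eq)
TVwalk⇒tail L (μ A) w e with tailOf A in eq
TVwalk⇒tail L (μ A) w refl | just (n , suc j) with TVwalk⇒tail (false ∷ L) A w eq
... | s<s l = l

TopVariant⇒tail : ∀ A {n j} → TopVariant A → tailOf A ≢ just (n , j)
TopVariant⇒tail A t e with TVwalk⇒tail [] A t e
... | ()

-- This is how properness acts on tails: a final variable in which the type is proper has at least
-- one `●` in front of it.
Proper⇒tail : ∀ {j} A → Proper j A → tailOf A ≢ just (0 , j)
Proper⇒tail (tvar j) p              e = p (,-injectiveʳ (just-injective e))
Proper⇒tail (A ⇒ B)  (inj₁ (p , q)) e = Proper⇒tail B q e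
Proper⇒tail (A ⇒ B)  (inj₂ t)       e = TopVariant⇒tail B t e
Proper⇒tail (● A)    p              e with tailOf A
Proper⇒tail (● A) p () | nothing
Proper⇒tail (● A) p () | just _
Proper⇒tail (μ A)    (inj₁ p)       e with tailOf A in eq
Proper⇒tail (μ A) (inj₁ p) refl | just (n , suc j) = Proper⇒tail A p eq
Proper⇒tail (μ A)    (inj₂ t)       e = TopVariant⇒tail (μ A) t e

delay-fixed : ∀ n t → t ≡ delay (suc n) t → t ≡ nothing
delay-fixed n nothing        e = refl
delay-fixed n (just (m , j)) e =
  contradiction (trans (cong suc (+-comm m n)) (sym (,-injectiveˡ (just-injective e)))) λ f →
    m+1+n≢m m (trans (+-suc m n) f)

≃-tail : ∀ {A B} → A ≃ B → tailOf A ≡ tailOf B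
≃-tail (≃-refl w)    = refl
≃-tail (≃-sym e)     = sym (≃-tail e)
≃-tail (≃-trans e f) = trans (≃-tail e) (≃-tail f)
≃-tail (≃-● e)       = cong (delay 1) (≃-tail e)
≃-tail (≃-⇒ e f)     = ≃-tail f
≃-tail (≃-⇒⊤ w)      = refl
≃-tail (≃-fold {A} w) rewrite tail-sub (sub0Ty (μ A)) A with tailOf A in eq
... | nothing          = refl
... | just (n , zero)  rewrite eq = refl
... | just (n , suc j) = cong (λ m → just (m , j)) (sym (+-identityʳ n))
≃-tail (≃-unique {A} {C} e p w) with ≃-tail e
... | eq rewrite tail-sub (sub0Ty A) C with tailOf C in eqC
...   | nothing             = eq
...   | just (zero , zero)  = contradiction eqC (Proper⇒tail C p)
-- The tail of `A` equals itself delayed by `suc n`; no finite count of bullets satisfies this.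
...   | just (suc n , zero) = delay-fixed n (tailOf A) eq
...   | just (n , suc j)    = trans eq (cong (λ m → just (m , j)) (+-identityʳ n))
≃-tail (≃-dist v w)  = refl

●⊤≃⊤ : ● ⊤ᵀ ≃ ⊤ᵀ
●⊤≃⊤ = ≃-sym (≃-fold WF-⊤)

-- A variable in tail position may be replaced by anything equal to ⊤, so the
-- uniqueness rule reduces ⊤ ≃ μX.A to ⊤ ≃ A[⊤/X].
sub-⊤ : ∀ {σ} A → WFSub σ → WF A → (∀ {n j} → tailOf A ≡ just (n , j) → σ j ≃ ⊤ᵀ) →
        subTy σ A ≃ ⊤ᵀ
sub-⊤ (tvar j) s w h       = h refl
sub-⊤ (A ⇒ B)  s (v , w) h =
  ≃-trans (≃-⇒ (≃-refl (WF-sub A s v)) (sub-⊤ B s w h)) (≃-⇒⊤ (WF-sub A s v))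
sub-⊤ (● A)    s w h       =
  ≃-trans (≃-● (sub-⊤ A s w λ e → h (cong (delay 1) e))) ●⊤≃⊤
sub-⊤ {σ} (μ A) s (p , w) h =
  ≃-sym (≃-unique (subst (⊤ᵀ ≃_) (sym (exts-sub0 σ A ⊤ᵀ)) (≃-sym (sub-⊤ A (WF-▸ WF-⊤ s) w h′)))
                  (Proper-exts σ A p) (WF-sub A (WF-exts s) w))
  where
  h′ : ∀ {n j} → tailOf A ≡ just (n , j) → (⊤ᵀ ▸ σ) j ≃ ⊤ᵀ
  h′ {j = zero}  e = ≃-refl WF-⊤
  h′ {j = suc j} e = h (cong unbind e)

-- Without a final variable the condition of `sub-⊤` is vacuous, so the identity substitution can be
-- used.
tail-nothing⇒⊤ : ∀ {A} → WF A → tailOf A ≡ nothing → A ≃ ⊤ᵀ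
tail-nothing⇒⊤ {A} w e = subst (_≃ ⊤ᵀ) (sub-id A) (sub-⊤ A (λ _ → tt) w absurd)
  where
  absurd : ∀ {n j} → tailOf A ≡ just (n , j) → tvar j ≃ ⊤ᵀ
  absurd e′ with trans (sym e) e′
  ... | ()

-- Head normal forms

-- The arrow form is found by recursion on the type: for `μ`, the head of the body is taken first
-- and unfolded afterwards. The equations are premises because substitutions in the indices would
-- obstruct pattern matching.
data Head : Ty → Ty → Ty → Set where
  head-⇒ : ∀ {P Q} → Head (P ⇒ Q) P Q
  head-● : ∀ {A P Q} → Head A P Q → Head (● A) (● P) (● Q)
  head-μ : ∀ {A P Q P′ Q′} → Head A P Q →
           P′ ≡ P [ μ A ]ᵀ → Q′ ≡ Q [ μ A ]ᵀ → Head (μ A) P′ Q′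

Head-sub : ∀ {A P Q} σ → Head A P Q → Head (subTy σ A) (subTy σ P) (subTy σ Q)
Head-sub σ head-⇒     = head-⇒
Head-sub σ (head-● h) = head-● (Head-sub σ h)
Head-sub σ (head-μ {A} {P} {Q} h refl refl) =
  head-μ (Head-sub (extsTy σ) h) (sub-sub0 σ P (μ A)) (sub-sub0 σ Q (μ A))

-- An arrow in `subTy σ A` stems either from `A` or from the type put for its final variable. In the
-- latter case that type is not a variable, which excludes bound variables, those left in place by
-- `sub0Ty`, and all renamings.
Head-sub⁻¹ : ∀ {P Q} σ A → Head (subTy σ A) P Q →
  (∃[ P₀ ] ∃[ Q₀ ] Head A P₀ Q₀ × P ≡ subTy σ P₀ × Q ≡ subTy σ Q₀) ⊎
  (∃[ n ] ∃[ j ] tailOf A ≡ just (n , j) × (∀ i → σ j ≢ tvar i))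
Head-sub⁻¹ σ (tvar j) h = inj₂ (0 , j , refl , notVar h)
  where
  notVar : ∀ {B P Q} → Head B P Q → ∀ i → B ≢ tvar i
  notVar () i refl
Head-sub⁻¹ σ (A ⇒ B) head-⇒ = inj₁ (A , B , head-⇒ , refl , refl)
Head-sub⁻¹ σ (● A) (head-● h) with Head-sub⁻¹ σ A h
... | inj₁ (P₀ , Q₀ , h₀ , refl , refl) = inj₁ (● P₀ , ● Q₀ , head-● h₀ , refl , refl)
... | inj₂ (n , j , e , ≢v)             = inj₂ (suc n , j , cong (delay 1) e , ≢v)
Head-sub⁻¹ σ (μ A) (head-μ h refl refl) with Head-sub⁻¹ (extsTy σ) A h
... | inj₁ (P₀ , Q₀ , h₀ , refl , refl) =
  inj₁ (_ , _ , head-μ h₀ refl refl , sym (sub-sub0 σ P₀ (μ A)) , sym (sub-sub0 σ Q₀ (μ A)))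
-- `extsTy σ` sends the bound variable to a variable, which has no head.
... | inj₂ (n , zero , e , ≢v)  = contradiction refl (≢v zero)
... | inj₂ (n , suc j , e , ≢v) =
  inj₂ (n , j , cong unbind e , λ i e′ → ≢v (suc i) (cong (renTy suc) e′))

Head-ren : ∀ {A P Q} ρ → Head A P Q → Head (renTy ρ A) (renTy ρ P) (renTy ρ Q)
Head-ren {A} {P} {Q} ρ h
  rewrite ren-as-sub ρ A | ren-as-sub ρ P | ren-as-sub ρ Q = Head-sub (tvar ∘ ρ) h

Head-ren⁻¹ : ∀ {P Q} ρ A → Head (renTy ρ A) P Q →
  ∃[ P₀ ] ∃[ Q₀ ] Head A P₀ Q₀ × P ≡ renTy ρ P₀ × Q ≡ renTy ρ Q₀
Head-ren⁻¹ {P} {Q} ρ A h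
  with Head-sub⁻¹ (tvar ∘ ρ) A (subst (λ B → Head B P Q) (ren-as-sub ρ A) h)
... | inj₁ (P₀ , Q₀ , h₀ , e , f) =
  P₀ , Q₀ , h₀ , trans e (sym (ren-as-sub ρ P₀)) , trans f (sym (ren-as-sub ρ Q₀))
... | inj₂ (n , j , e , ≢v) = contradiction refl (≢v (ρ j))

Head-≃ : ∀ {A P Q} → WF A → Head A P Q → A ≃ (P ⇒ Q)
Head-≃ w head-⇒     = ≃-refl w
Head-≃ w (head-● h) with Head-≃ w h
... | e = ≃-trans (≃-● e) (≃-dist (proj₁ (proj₂ (≃-wf e))) (proj₂ (proj₂ (≃-wf e))))
Head-≃ w (head-μ h refl refl) =
  ≃-trans (≃-fold w) (≃-sub _ (WF-sub0 w) (Head-≃ (proj₂ w) h))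

Head-wf : ∀ {A P Q} → WF A → Head A P Q → WF P × WF Q
Head-wf w h = proj₂ (≃-wf (Head-≃ w h))

-- The first alternative says that `B` is ⊤; it accounts for `≃-⇒⊤`, by which an arrow may
-- disappear.
Match : Ty → Ty → Set
Match A B = ∀ {P Q} → Head A P Q →
  tailOf B ≡ nothing ⊎ (∃[ P′ ] ∃[ Q′ ] Head B P′ Q′ × P ≃ P′ × Q ≃ Q′)

Match-refl : ∀ {A} → WF A → Match A A
Match-refl w h with Head-wf w h
... | wP , wQ = inj₂ (_ , _ , h , ≃-refl wP , ≃-refl wQ)

Match-trans : ∀ {A B C} → B ≃ C → Match A B → Match B C → Match A C
Match-trans e m₁ m₂ h with m₁ h
... | inj₁ t = inj₁ (trans (sym (≃-tail e)) t)
... | inj₂ (_ , _ , h′ , p , q) with m₂ h′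
...   | inj₁ t = inj₁ t
...   | inj₂ (_ , _ , h″ , p′ , q′) = inj₂ (_ , _ , h″ , ≃-trans p p′ , ≃-trans q q′)

Match-● : ∀ {A B} → Match A B → Match (● A) (● B)
Match-● m (head-● h) with m h
... | inj₁ t = inj₁ (cong (delay 1) t)
... | inj₂ (_ , _ , h′ , p , q) = inj₂ (_ , _ , head-● h′ , ≃-● p , ≃-● q)

-- If the arrow comes from the inserted `A`, the variable bound in `μ C` ends the tail of `C`, and
-- `μ C` is an infinite sequence of bullets.
Head-sub0⁻¹ : ∀ {P Q} A C → Head (C [ A ]ᵀ) P Q →
  tailOf (μ C) ≡ nothing ⊎
  (∃[ P₀ ] ∃[ Q₀ ] Head C P₀ Q₀ × P ≡ P₀ [ A ]ᵀ × Q ≡ Q₀ [ A ]ᵀ)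
Head-sub0⁻¹ A C h with Head-sub⁻¹ (sub0Ty A) C h
... | inj₁ r                   = inj₂ r
... | inj₂ (n , zero , e , ≢v)  = inj₁ (cong unbind e)
... | inj₂ (n , suc j , e , ≢v) = contradiction refl (≢v j)

-- Both directions are proved at once, so that `≃-sym` is a swap and the induction stays structural.
≃-match : ∀ {A B} → A ≃ B → Match A B × Match B A
≃-match (≃-refl w) = Match-refl w , Match-refl w
≃-match (≃-sym e)  = proj₂ (≃-match e) , proj₁ (≃-match e)
≃-match (≃-trans e f) =
  Match-trans f (proj₁ (≃-match e)) (proj₁ (≃-match f)) ,
  Match-trans (≃-sym e) (proj₂ (≃-match f)) (proj₂ (≃-match e))
≃-match (≃-● e) = Match-● (proj₁ (≃-match e)) , Match-● (proj₂ (≃-match e))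
≃-match (≃-⇒ e f) =
  (λ { head-⇒ → inj₂ (_ , _ , head-⇒ , e , f) }) ,
  (λ { head-⇒ → inj₂ (_ , _ , head-⇒ , ≃-sym e , ≃-sym f) })
≃-match (≃-⇒⊤ w) = (λ _ → inj₁ refl) , (λ _ → inj₁ refl)
≃-match (≃-fold {A} w) = to , from
  where
  to : Match (μ A) (A [ μ A ]ᵀ)
  to (head-μ h refl refl) = Match-refl (proj₂ (≃-wf (≃-fold w))) (Head-sub _ h)
  from : Match (A [ μ A ]ᵀ) (μ A)
  from h with Head-sub0⁻¹ (μ A) A h
  ... | inj₁ t = inj₁ t
  ... | inj₂ (_ , _ , h₀ , refl , refl) = Match-refl w (head-μ h₀ refl refl)
≃-match (≃-unique {A} {C} e p w) = to , from
  where
  A≃μC : A ≃ μ C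
  A≃μC = ≃-unique e p w
  to : Match A (μ C)
  to h with proj₁ (≃-match e) h
  ... | inj₁ t = inj₁ (trans (sym (≃-tail A≃μC)) (trans (≃-tail e) t))
  ... | inj₂ (_ , _ , h′ , r , s) with Head-sub0⁻¹ A C h′
  ...   | inj₁ t = inj₁ t
  ...   | inj₂ (P₀ , Q₀ , h₀ , refl , refl) with Head-wf w h₀
  -- The components are `P₀` and `Q₀` with `A` inserted on one side and `μ C` on the other; the
  -- equality `A ≃ μ C` being analysed is itself what relates them.
  ...     | wP , wQ = inj₂ (_ , _ , head-μ h₀ refl refl ,
                            ≃-trans r (sub0-≃ P₀ A≃μC wP) , ≃-trans s (sub0-≃ Q₀ A≃μC wQ))
  from : Match (μ C) A
  from (head-μ {P = P₀} {Q = Q₀} h₀ refl refl) with proj₂ (≃-match e) (Head-sub (sub0Ty A) h₀)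
  ... | inj₁ t = inj₁ t
  ... | inj₂ (_ , _ , h , r , s) with Head-wf w h₀
  ...   | wP , wQ = inj₂ (_ , _ , h , ≃-trans (sub0-≃ P₀ (≃-sym A≃μC) wP) r ,
                                      ≃-trans (sub0-≃ Q₀ (≃-sym A≃μC) wQ) s)
≃-match (≃-dist v w) =
  (λ { (head-● head-⇒) → Match-refl (v , w) head-⇒ }) ,
  (λ { head-⇒ → Match-refl (v , w) (head-● head-⇒) })

-- Subtyping

Valid-[] : Valid []
Valid-[] ()

shift2-injective : ∀ {m n} → shift2 m ≡ shift2 n → m ≡ n
shift2-injective refl = refl

shiftPair-injective : ∀ {p q} → shiftPair p ≡ shiftPair q → p ≡ q
shiftPair-injective refl = refl

under : Assm → Assm
under γ = (zero , suc zero) ∷ map shiftPair γ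

Valid-under : ∀ {γ} → Valid γ → Valid (under γ)
Valid-under v (here refl) (here refl) = (λ ()) , (λ _ → refl) , (λ _ → refl)
Valid-under v (here refl) (there q) with ∈-map⁻ shiftPair q
... | _ , _ , refl = (λ ()) , (λ ()) , (λ ())
Valid-under v (there p) (here refl) with ∈-map⁻ shiftPair p
... | _ , _ , refl = (λ ()) , (λ ()) , (λ ())
Valid-under v (there p) (there q) with ∈-map⁻ shiftPair p | ∈-map⁻ shiftPair q
... | _ , p′ , refl | _ , q′ , refl with v p′ q′
...   | f≢s , f , s = f≢s ∘ shift2-injective ,
                      cong shiftPair ∘ f ∘ shift2-injective ,
                      cong shiftPair ∘ s ∘ shift2-injective

-- The rule `⪯-μ` carries no validity premise of its own; validity of `γ` is recovered from its
-- extended assumptions.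
Valid-under⁻¹ : ∀ {γ} → Valid (under γ) → Valid γ
Valid-under⁻¹ v p q with v (there (∈-map⁺ shiftPair p)) (there (∈-map⁺ shiftPair q))
... | f≢s , f , s = f≢s ∘ cong shift2 ,
                    shiftPair-injective ∘ f ∘ cong shift2 ,
                    shiftPair-injective ∘ s ∘ cong shift2

⪯-valid : ∀ {γ A B} → γ ⊢ A ⪯ B → Valid γ
⪯-valid (⪯-assm v _)      = v
⪯-valid (⪯-top v _)       = v
⪯-valid (⪯-eq v _)        = v
⪯-valid (⪯-trans _ _ _ v) = v
⪯-valid (⪯-● d)           = ⪯-valid d
⪯-valid (⪯-⇒ _ _ _ v)     = v
⪯-valid (⪯-μ d _ _)       = Valid-under⁻¹ (⪯-valid d)
⪯-valid (⪯-●ʳ v _)        = v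

-- A left inverse undoes the renaming, and substitution preserves well-formedness.
WF-ren⁻¹ : ∀ {ρ} (ρ⁻¹ : ℕ → ℕ) A → (∀ n → ρ⁻¹ (ρ n) ≡ n) → WF (renTy ρ A) → WF A
WF-ren⁻¹ {ρ} ρ⁻¹ A inv w =
  subst WF (trans (sub-ren (tvar ∘ ρ⁻¹) ρ A) (trans (sub-cong (cong tvar ∘ inv) A) (sub-id A)))
        (WF-sub (renTy ρ A) (λ _ → tt) w)

-- One left inverse serves both `ρL` and `ρR`: the indices 0 and 1 of the two bound variables both
-- return to 0.
ρ⁻¹ : ℕ → ℕ
ρ⁻¹ (suc (suc n)) = suc n
ρ⁻¹ _             = zero

ρ⁻¹-ρL : ∀ n → ρ⁻¹ (ρL n) ≡ n
ρ⁻¹-ρL zero    = refl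
ρ⁻¹-ρL (suc n) = refl

ρ⁻¹-ρR : ∀ n → ρ⁻¹ (ρR n) ≡ n
ρ⁻¹-ρR zero    = refl
ρ⁻¹-ρR (suc n) = refl

⪯-wf : ∀ {γ A B} → γ ⊢ A ⪯ B → WF A × WF B
⪯-wf (⪯-assm _ _)      = tt , tt
⪯-wf (⪯-top _ w)       = w , WF-⊤
⪯-wf (⪯-eq _ e)        = ≃-wf e
⪯-wf (⪯-trans d e _ _) = proj₁ (⪯-wf d) , proj₂ (⪯-wf e)
⪯-wf (⪯-● d)           = ⪯-wf d
⪯-wf (⪯-⇒ d e _ _)     = (proj₂ (⪯-wf d) , proj₁ (⪯-wf e)) , (proj₁ (⪯-wf d) , proj₂ (⪯-wf e))
⪯-wf (⪯-μ {A = A} {B} d p q) =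
  (p , WF-ren⁻¹ ρ⁻¹ A ρ⁻¹-ρL (proj₁ (⪯-wf d))) ,
  (q , WF-ren⁻¹ ρ⁻¹ B ρ⁻¹-ρR (proj₂ (⪯-wf d)))
⪯-wf (⪯-●ʳ _ w)        = w , w

union-left : ∀ {γ₁ γ₂ γ p} → IsUnion γ₁ γ₂ γ → p ∈ γ₁ → p ∈ γ
union-left u = Equivalence.from (u _) ∘ inj₁

union-right : ∀ {γ₁ γ₂ γ p} → IsUnion γ₁ γ₂ γ → p ∈ γ₂ → p ∈ γ
union-right u = Equivalence.from (u _) ∘ inj₂

union-self : ∀ {γ} → IsUnion γ γ γ
union-self p = mk⇔ inj₁ [ id , id ]′

⪯-trans′ : ∀ {γ A B C} → γ ⊢ A ⪯ B → γ ⊢ B ⪯ C → γ ⊢ A ⪯ C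
⪯-trans′ d e = ⪯-trans d e union-self (⪯-valid d)

⪯-refl : ∀ {γ A} → Valid γ → WF A → γ ⊢ A ⪯ A
⪯-refl v w = ⪯-eq v (≃-refl w)

-- Substitution in subtyping derivations

under-sub : (ℕ → Ty) → ℕ → Ty
under-sub σ zero          = tvar zero
under-sub σ (suc zero)    = tvar (suc zero)
under-sub σ (suc (suc n)) = renTy shift2 (σ n)

-- Substituting in the joint scope of the two binders of `⪯-μ` agrees with substituting under the
-- left `μ` alone; `under-sub-ρR` is the mirror image.
under-sub-ρL : ∀ σ A → subTy (under-sub σ) (renTy ρL A) ≡ renTy ρL (subTy (extsTy σ) A)
under-sub-ρL σ A = trans (sub-ren (under-sub σ) ρL A)
  (trans (sub-cong pointwise A) (sym (ren-sub ρL (extsTy σ) A)))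
  where
  pointwise : under-sub σ ∘ ρL ≗ renTy ρL ∘ extsTy σ
  pointwise zero    = refl
  pointwise (suc n) = sym (ren-ren ρL suc (σ n))

under-sub-ρR : ∀ σ A → subTy (under-sub σ) (renTy ρR A) ≡ renTy ρR (subTy (extsTy σ) A)
under-sub-ρR σ A = trans (sub-ren (under-sub σ) ρR A)
  (trans (sub-cong pointwise A) (sym (ren-sub ρR (extsTy σ) A)))
  where
  pointwise : under-sub σ ∘ ρR ≗ renTy ρR ∘ extsTy σ
  pointwise zero    = refl
  pointwise (suc n) = sym (ren-ren ρR suc (σ n))

-- Substitution is proved for any property S of substitutions that is preserved
-- when going under μ, so as to instantiate it first with renamings, which are
-- themselves needed to shift the substituted derivations under μ.
module Substitution
  (S : (ℕ → Ty) → Assm → Assm → Set)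
  (S-assm  : ∀ {σ γ δ X Y} → S σ γ δ → (X , Y) ∈ γ → δ ⊢ σ X ⪯ σ Y)
  (S-wf    : ∀ {σ γ δ} → S σ γ δ → WFSub σ)
  (S-valid : ∀ {σ γ δ} → S σ γ δ → Valid δ)
  (S-⊆     : ∀ {σ γ γ′ δ} → (∀ {p} → p ∈ γ → p ∈ γ′) → S σ γ′ δ → S σ γ δ)
  (S-under : ∀ {σ γ δ} → S σ γ δ → S (under-sub σ) (under γ) (under δ))
  where

  ⪯-sub : ∀ {σ γ δ A B} → S σ γ δ → γ ⊢ A ⪯ B → δ ⊢ subTy σ A ⪯ subTy σ B
  ⪯-sub s (⪯-assm _ m) = S-assm s m
  ⪯-sub s (⪯-top {A = A} _ w) = ⪯-top (S-valid s) (WF-sub A (S-wf s) w)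
  ⪯-sub s (⪯-eq _ e) = ⪯-eq (S-valid s) (≃-sub _ (S-wf s) e)
  ⪯-sub s (⪯-trans d e u _) =
    ⪯-trans′ (⪯-sub (S-⊆ (union-left u) s) d) (⪯-sub (S-⊆ (union-right u) s) e)
  ⪯-sub s (⪯-● d) = ⪯-● (⪯-sub s d)
  ⪯-sub s (⪯-⇒ d e u _) =
    ⪯-⇒ (⪯-sub (S-⊆ (union-left u) s) d) (⪯-sub (S-⊆ (union-right u) s) e) union-self (S-valid s)
  ⪯-sub {σ} {δ = δ} s (⪯-μ {A = A} {B} d p q) =
    ⪯-μ (subst₂ (under δ ⊢_⪯_) (under-sub-ρL σ A) (under-sub-ρR σ B) (⪯-sub (S-under s) d))
        (Proper-exts σ A p) (Proper-exts σ B q)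
  ⪯-sub s (⪯-●ʳ {A = A} _ w) = ⪯-●ʳ (S-valid s) (WF-sub A (S-wf s) w)

-- The substitution is a renaming only up to pointwise equality, since `under-sub` applied to a
-- renaming is not definitionally one.
record RenSub (σ : ℕ → Ty) (γ δ : Assm) : Set where
  field
    ρ     : ℕ → ℕ
    σ≗ρ   : σ ≗ tvar ∘ ρ
    assm  : ∀ {X Y} → (X , Y) ∈ γ → (ρ X , ρ Y) ∈ δ
    valid : Valid δ

RenSub-under : ∀ {σ γ δ} → RenSub σ γ δ → RenSub (under-sub σ) (under γ) (under δ)
RenSub-under {σ} {γ} {δ} s = record
  { ρ     = ext (ext ρ)
  ; σ≗ρ   = λ { zero → refl ; (suc zero) → refl ; (suc (suc n)) → cong (renTy shift2) (σ≗ρ n) }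
  ; assm  = assm′
  ; valid = Valid-under valid
  }
  where
  open RenSub s
  assm′ : ∀ {X Y} → (X , Y) ∈ under γ → (ext (ext ρ) X , ext (ext ρ) Y) ∈ under δ
  assm′ (here refl) = here refl
  assm′ (there m) with ∈-map⁻ shiftPair m
  ... | _ , m′ , refl = there (∈-map⁺ shiftPair (assm m′))

RenSub-assm : ∀ {σ γ δ X Y} → RenSub σ γ δ → (X , Y) ∈ γ → δ ⊢ σ X ⪯ σ Y
RenSub-assm {δ = δ} s m = subst₂ (δ ⊢_⪯_) (sym (σ≗ρ _)) (sym (σ≗ρ _)) (⪯-assm valid (assm m))
  where open RenSub s

RenSub-wf : ∀ {σ γ δ} → RenSub σ γ δ → WFSub σ
RenSub-wf s n = subst WF (sym (RenSub.σ≗ρ s n)) tt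

RenSub-⊆ : ∀ {σ γ γ′ δ} → (∀ {p} → p ∈ γ → p ∈ γ′) → RenSub σ γ′ δ → RenSub σ γ δ
RenSub-⊆ γ⊆γ′ s = record { ρ = ρ ; σ≗ρ = σ≗ρ ; assm = assm ∘ γ⊆γ′ ; valid = valid }
  where open RenSub s

module Renaming = Substitution RenSub RenSub-assm RenSub-wf RenSub.valid RenSub-⊆ RenSub-under

⪯-weaken : ∀ {γ δ A B} → (∀ {p} → p ∈ γ → p ∈ δ) → Valid δ → γ ⊢ A ⪯ B → δ ⊢ A ⪯ B
⪯-weaken {δ = δ} {A} {B} γ⊆δ v d =
  subst₂ (δ ⊢_⪯_) (sub-id A) (sub-id B)
    (Renaming.⪯-sub (record { ρ = id ; σ≗ρ = λ _ → refl ; assm = γ⊆δ ; valid = v }) d)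

⪯-shift2 : ∀ {γ A B} → γ ⊢ A ⪯ B → under γ ⊢ renTy shift2 A ⪯ renTy shift2 B
⪯-shift2 {γ} {A} {B} d =
  subst₂ (under γ ⊢_⪯_) (sym (ren-as-sub shift2 A)) (sym (ren-as-sub shift2 B))
    (Renaming.⪯-sub (record
      { ρ = shift2 ; σ≗ρ = λ _ → refl
      ; assm = there ∘ ∈-map⁺ shiftPair ; valid = Valid-under (⪯-valid d) }) d)

-- Assumptions are replaced by derivations; this serves to discharge the pair introduced by `⪯-μ`.
record AssmSub (σ : ℕ → Ty) (γ δ : Assm) : Set where
  field
    assm  : ∀ {X Y} → (X , Y) ∈ γ → δ ⊢ σ X ⪯ σ Y
    wf    : WFSub σ
    valid : Valid δ

AssmSub-under : ∀ {σ γ δ} → AssmSub σ γ δ → AssmSub (under-sub σ) (under γ) (under δ)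
AssmSub-under {σ} {γ} {δ} s = record
  { assm  = assm′
  ; wf    = λ { zero → tt ; (suc zero) → tt ; (suc (suc n)) → WF-ren shift2 (σ n) (wf n) }
  ; valid = Valid-under valid
  }
  where
  open AssmSub s
  assm′ : ∀ {X Y} → (X , Y) ∈ under γ → under δ ⊢ under-sub σ X ⪯ under-sub σ Y
  assm′ (here refl) = ⪯-assm (Valid-under valid) (here refl)
  assm′ (there m) with ∈-map⁻ shiftPair m
  ... | _ , m′ , refl = ⪯-shift2 (assm m′)

AssmSub-⊆ : ∀ {σ γ γ′ δ} → (∀ {p} → p ∈ γ → p ∈ γ′) → AssmSub σ γ′ δ → AssmSub σ γ δ
AssmSub-⊆ γ⊆γ′ s = record { assm = assm ∘ γ⊆γ′ ; wf = wf ; valid = valid }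
  where open AssmSub s

AssmSub-assm : ∀ {σ γ δ X Y} → AssmSub σ γ δ → (X , Y) ∈ γ → δ ⊢ σ X ⪯ σ Y
AssmSub-assm s = AssmSub.assm s

open Substitution AssmSub AssmSub-assm AssmSub.wf AssmSub.valid AssmSub-⊆ AssmSub-under using (⪯-sub)

-- Tails along subtyping

data TailLe (γ : Assm) : Tail → Tail → Set where
  le-⊤    : ∀ {t} → TailLe γ t nothing
  le-same : ∀ {m n j} → TailLe γ (just (m , j)) (just (n , j))
  le-assm : ∀ {m n i j} → (i , j) ∈ γ → TailLe γ (just (m , i)) (just (n , j))

TailLe-refl : ∀ {γ} t → TailLe γ t t
TailLe-refl nothing  = le-⊤
TailLe-refl (just _) = le-same

TailLe-weaken : ∀ {γ δ s t} → (∀ {p} → p ∈ γ → p ∈ δ) → TailLe γ s t → TailLe δ s t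
TailLe-weaken γ⊆δ le-⊤        = le-⊤
TailLe-weaken γ⊆δ le-same     = le-same
TailLe-weaken γ⊆δ (le-assm m) = le-assm (γ⊆δ m)

TailLe-trans : ∀ {γ r s t} → Valid γ → TailLe γ r s → TailLe γ s t → TailLe γ r t
TailLe-trans v _           le-⊤         = le-⊤
TailLe-trans v le-same     le-same      = le-same
TailLe-trans v le-same     (le-assm m)  = le-assm m
TailLe-trans v (le-assm m) le-same      = le-assm m
-- Chained assumptions would use the middle variable on both sides, which validity forbids.
TailLe-trans v (le-assm m) (le-assm m′) = contradiction refl (proj₁ (v m′ m))

TailLe-delay : ∀ {γ s t} → TailLe γ s t → TailLe γ (delay 1 s) (delay 1 t)
TailLe-delay le-⊤        = le-⊤
TailLe-delay le-same     = le-same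
TailLe-delay (le-assm m) = le-assm m

TailLe-delayʳ : ∀ {γ} t → TailLe γ t (delay 1 t)
TailLe-delayʳ nothing  = le-⊤
TailLe-delayʳ (just _) = le-same

-- The bound variables get indices 0 and 1 and are paired only with each other. Hence a left tail
-- ending in its bound variable forces the right one to do likewise or to be `nothing`, and binding
-- keeps the order.
TailLe-unbind : ∀ {γ} s t →
  TailLe (under γ) (mapMaybe (map₂ ρL) s) (mapMaybe (map₂ ρR) t) → TailLe γ (unbind s) (unbind t)
TailLe-unbind s nothing           l = le-⊤
TailLe-unbind s (just (n , zero)) l = le-⊤
TailLe-unbind nothing (just (n , suc j)) ()
TailLe-unbind (just (m , zero)) (just (n , suc j)) (le-assm (there l)) with ∈-map⁻ shiftPair l
... | _ , _ , ()
TailLe-unbind (just (m , suc i)) (just (n , suc j)) le-same = le-same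
TailLe-unbind (just (m , suc i)) (just (n , suc j)) (le-assm (there l)) with ∈-map⁻ shiftPair l
... | _ , l′ , refl = le-assm l′

⪯-tail : ∀ {γ A B} → γ ⊢ A ⪯ B → TailLe γ (tailOf A) (tailOf B)
⪯-tail (⪯-assm _ m)      = le-assm m
⪯-tail (⪯-top _ _)       = le-⊤
⪯-tail (⪯-eq {A = A} _ e) = subst (TailLe _ (tailOf A)) (≃-tail e) (TailLe-refl (tailOf A))
⪯-tail (⪯-trans d e u v) = TailLe-trans v (TailLe-weaken (union-left u) (⪯-tail d))
                                          (TailLe-weaken (union-right u) (⪯-tail e))
⪯-tail (⪯-● d)           = TailLe-delay (⪯-tail d)
⪯-tail (⪯-⇒ d e u _)     = TailLe-weaken (union-right u) (⪯-tail e)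
⪯-tail (⪯-μ {A = A} {B} d _ _) = TailLe-unbind (tailOf A) (tailOf B)
  (subst₂ (TailLe _) (tail-ren ρL A) (tail-ren ρR B) (⪯-tail d))
⪯-tail (⪯-●ʳ {A = A} _ _) = TailLe-delayʳ (tailOf A)

-- ⊤ is maximal because `TailLe` places `nothing` below `nothing` only.
⪯-tail-⊤ : ∀ {γ A B} → γ ⊢ A ⪯ B → tailOf A ≡ nothing → tailOf B ≡ nothing
⪯-tail-⊤ d e = least (subst (λ s → TailLe _ s _) e (⪯-tail d))
  where
  least : ∀ {γ t} → TailLe γ nothing t → t ≡ nothing
  least le-⊤ = refl

-- Inversion of subtyping at arrows

●^ : ℕ → Ty → Ty
●^ zero    A = A
●^ (suc k) A = ● (●^ k A)

●^-comm : ∀ k A → ●^ k (● A) ≡ ● (●^ k A)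
●^-comm zero    A = refl
●^-comm (suc k) A = cong ● (●^-comm k A)

●^-+ : ∀ k l A → ●^ k (●^ l A) ≡ ●^ (k + l) A
●^-+ zero    l A = refl
●^-+ (suc k) l A = cong ● (●^-+ k l A)

sub-●^ : ∀ σ k A → subTy σ (●^ k A) ≡ ●^ k (subTy σ A)
sub-●^ σ zero    A = refl
sub-●^ σ (suc k) A = cong ● (sub-●^ σ k A)

⪯-●^ : ∀ {γ A B} k → γ ⊢ A ⪯ B → γ ⊢ ●^ k A ⪯ ●^ k B
⪯-●^ zero    d = d
⪯-●^ (suc k) d = ⪯-● (⪯-●^ k d)

-- The exponent `k` accumulates from uses of `⪯-●ʳ` on the arrow as a whole. It is common to domain
-- and codomain, as `●` distributes over the arrow.
SubHead : Assm → Ty → Ty → Ty → Set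
SubHead γ P Q B = tailOf B ≡ nothing ⊎
  (∃[ P′ ] ∃[ Q′ ] ∃[ k ] Head B P′ Q′ × (γ ⊢ P′ ⪯ ●^ k P) × (γ ⊢ ●^ k Q ⪯ Q′))

-- Induction on the derivation: transitivity adds delays. For `⪯-μ` the components are first
-- compared under the extra assumption, which is then replaced by the conclusion of the rule.
⪯-head : ∀ {γ A B P Q} → γ ⊢ A ⪯ B → Head A P Q → SubHead γ P Q B
⪯-head (⪯-top _ _) h = inj₁ refl
⪯-head (⪯-eq v e) h with proj₁ (≃-match e) h
... | inj₁ t = inj₁ t
... | inj₂ (_ , _ , h′ , p , q) = inj₂ (_ , _ , 0 , h′ , ⪯-eq v (≃-sym p) , ⪯-eq v q)
⪯-head {P = P} {Q} (⪯-trans d e u v) h with ⪯-head d h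
... | inj₁ t = inj₁ (⪯-tail-⊤ e t)
... | inj₂ (_ , _ , k , h′ , p , q) with ⪯-head e h′
...   | inj₁ t = inj₁ t
...   | inj₂ (P″ , Q″ , l , h″ , p′ , q′) = inj₂ (_ , _ , l + k , h″ ,
          subst (_ ⊢ P″ ⪯_) (●^-+ l k P) (⪯-trans′ (fromʳ p′) (⪯-●^ l (fromˡ p))) ,
          subst (_ ⊢_⪯ Q″) (●^-+ l k Q) (⪯-trans′ (⪯-●^ l (fromˡ q)) (fromʳ q′)))
  where
  fromˡ : ∀ {A B} → _ ⊢ A ⪯ B → _ ⊢ A ⪯ B
  fromˡ = ⪯-weaken (union-left u) v
  fromʳ : ∀ {A B} → _ ⊢ A ⪯ B → _ ⊢ A ⪯ B
  fromʳ = ⪯-weaken (union-right u) v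
⪯-head (⪯-● d) (head-● {P = P} {Q} h) with ⪯-head d h
... | inj₁ t = inj₁ (cong (delay 1) t)
... | inj₂ (P′ , Q′ , k , h′ , p , q) = inj₂ (_ , _ , k , head-● h′ ,
        subst (_ ⊢ ● P′ ⪯_) (sym (●^-comm k P)) (⪯-● p) ,
        subst (_ ⊢_⪯ ● Q′) (sym (●^-comm k Q)) (⪯-● q))
⪯-head (⪯-⇒ d e u v) head-⇒ =
  inj₂ (_ , _ , 0 , head-⇒ , ⪯-weaken (union-left u) v d , ⪯-weaken (union-right u) v e)
⪯-head {γ} d@(⪯-μ {A = A} {B} d′ p q) (head-μ {P = P} {Q} h refl refl)
  with ⪯-head d′ (Head-ren ρL h)
... | inj₁ t = inj₁ (cong unbind (map-nothing⁻¹ (tailOf B) (trans (sym (tail-ren ρR B)) t)))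
... | inj₂ (_ , _ , k , h′ , r , s) with Head-ren⁻¹ ρR B h′
...   | P′ , Q′ , h₀ , refl , refl = inj₂ (_ , _ , k , head-μ h₀ refl refl ,
          subst₂ (γ ⊢_⪯_) (τ-ρR P′) (τ-●^ρL P) (⪯-sub τ-ok r) ,
          subst₂ (γ ⊢_⪯_) (τ-●^ρL Q) (τ-ρR Q′) (⪯-sub τ-ok s))
  where
  τ : ℕ → Ty
  -- The left bound variable (index 0) becomes `μ A`, the right one (index 1) `μ B`, and the outer
  -- indices drop by two.
  τ = μ A ▸ μ B ▸ tvar
  τ-ok : AssmSub τ (under γ) γ
  τ-ok = record
    { assm  = assm
    ; wf    = WF-▸ (proj₁ (⪯-wf d)) (WF-▸ (proj₂ (⪯-wf d)) (λ _ → tt))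
    ; valid = ⪯-valid d
    }
    where
    assm : ∀ {X Y} → (X , Y) ∈ under γ → γ ⊢ τ X ⪯ τ Y
    -- The assumed pair is instantiated by the very derivation under analysis.
    assm (here refl) = d
    assm (there m) with ∈-map⁻ shiftPair m
    ... | _ , m′ , refl = ⪯-assm (⪯-valid d) m′
  τ-ρL : ∀ C → subTy τ (renTy ρL C) ≡ C [ μ A ]ᵀ
  τ-ρL C = trans (sub-ren τ ρL C) (sub-cong (λ { zero → refl ; (suc n) → refl }) C)
  τ-ρR : ∀ C → subTy τ (renTy ρR C) ≡ C [ μ B ]ᵀ
  τ-ρR C = trans (sub-ren τ ρR C) (sub-cong (λ { zero → refl ; (suc n) → refl }) C)
  τ-●^ρL : ∀ C → subTy τ (●^ k (renTy ρL C)) ≡ ●^ k (C [ μ A ]ᵀ)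
  τ-●^ρL C = trans (sub-●^ τ k (renTy ρL C)) (cong (●^ k) (τ-ρL C))
⪯-head (⪯-●ʳ v w) h with Head-wf w h
-- Here a delay arises: the head of `● A` is that of `A` with one `●` on each component.
... | wP , wQ = inj₂ (_ , _ , 1 , head-● h , ⪯-refl v wP , ⪯-refl v wQ)

-- Typing

mapMaybe-●⁻¹ : ∀ {a A} → mapMaybe ● a ≡ just A → ∃[ B ] a ≡ just B × A ≡ ● B
mapMaybe-●⁻¹ {just B} refl = B , refl , refl

lookup-●C : ∀ Γ n → lookupC (●C Γ) n ≡ mapMaybe ● (lookupC Γ n)
lookup-●C []      n       = refl
lookup-●C (a ∷ Γ) zero    = refl
lookup-●C (a ∷ Γ) (suc n) = lookup-●C Γ n

lookup-●C⁺ : ∀ Γ n {A} → lookupC Γ n ≡ just A → lookupC (●C Γ) n ≡ just (● A)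
lookup-●C⁺ Γ n e = trans (lookup-●C Γ n) (cong (mapMaybe ●) e)

lookup-●C⁻ : ∀ Γ n {A} → lookupC (●C Γ) n ≡ just A → ∃[ B ] lookupC Γ n ≡ just B × A ≡ ● B
lookup-●C⁻ Γ n e = mapMaybe-●⁻¹ (trans (sym (lookup-●C Γ n)) e)

WFC-●⁺ : ∀ Γ → WFC Γ → WFC (●C Γ)
WFC-●⁺ Γ w n A e with lookup-●C⁻ Γ n e
... | B , e′ , refl = w n B e′

WFC-●⁻ : ∀ Γ → WFC (●C Γ) → WFC Γ
WFC-●⁻ Γ w n A e = w n (● A) (lookup-●C⁺ Γ n e)

WFC-∷ : ∀ {A Γ} → WF A → WFC Γ → WFC (just A ∷ Γ)
WFC-∷ v w zero    _ refl = v
WFC-∷ v w (suc n) A e    = w n A e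

UnionAt-left : ∀ {a b c A} → UnionAt a b c → a ≡ just A → c ≡ just A
UnionAt-left left e = e
UnionAt-left both e = e

UnionAt-right : ∀ {a b c A} → UnionAt a b c → b ≡ just A → c ≡ just A
UnionAt-right right e = e
UnionAt-right both  e = e

UnionAt-inv : ∀ {a b c A} → UnionAt a b c → c ≡ just A → a ≡ just A ⊎ b ≡ just A
UnionAt-inv left  e = inj₁ e
UnionAt-inv right e = inj₂ e
UnionAt-inv both  e = inj₁ e

CtxUnion-self : ∀ Γ → CtxUnion Γ Γ Γ
CtxUnion-self Γ n with lookupC Γ n
... | nothing = none
... | just _  = both

CtxUnion-● : ∀ Γ₁ Γ₂ Γ → CtxUnion Γ₁ Γ₂ Γ → CtxUnion (●C Γ₁) (●C Γ₂) (●C Γ)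
CtxUnion-● Γ₁ Γ₂ Γ u n rewrite lookup-●C Γ₁ n | lookup-●C Γ₂ n | lookup-●C Γ n
  with u n
... | e = UnionAt-map e
  where
  UnionAt-map : ∀ {a b c} → UnionAt a b c →
                UnionAt (mapMaybe ● a) (mapMaybe ● b) (mapMaybe ● c)
  UnionAt-map none  = none
  UnionAt-map left  = left
  UnionAt-map right = right
  UnionAt-map both  = both

⊢-wf : ∀ {Γ M A} → Γ ⊢ M ∶ A → WFC Γ × WF A
⊢-wf (ty-var w e) = w , w _ _ e
⊢-wf {Γ} (ty-● t) = WFC-●⁻ Γ (proj₁ (⊢-wf t)) , proj₂ (⊢-wf t)
⊢-wf (ty-⊤ w)     = w , WF-⊤
⊢-wf (ty-⪯ t d)   = proj₁ (⊢-wf t) , proj₂ (⪯-wf d)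
⊢-wf (ty-ƛ t)     = (λ n → proj₁ (⊢-wf t) (suc n)) , (proj₁ (⊢-wf t) zero _ refl , proj₂ (⊢-wf t))
⊢-wf (ty-· t s u) =
  (λ n A e → [ proj₁ (⊢-wf t) n A , proj₁ (⊢-wf s) n A ]′ (UnionAt-inv (u n) e)) ,
  proj₂ (proj₂ (⊢-wf t))

⪯-≃ : ∀ {A B} → A ≃ B → A ⪯ B
⪯-≃ = ⪯-eq Valid-[]

-- A converse to `ty-●`. Abstraction and application use the distribution of `●` over arrows in
-- opposite directions, and `ty-⊤` uses ⊤ ≃ `●` ⊤.
necessitation : ∀ {Γ M A} → Γ ⊢ M ∶ A → ●C Γ ⊢ M ∶ ● A
necessitation {Γ} (ty-var {x = x} w e) = ty-var (WFC-●⁺ Γ w) (lookup-●C⁺ Γ x e)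
necessitation (ty-● t)     = ty-● (necessitation t)
necessitation {Γ} (ty-⊤ w) = ty-⪯ (ty-⊤ (WFC-●⁺ Γ w)) (⪯-≃ (≃-sym ●⊤≃⊤))
necessitation (ty-⪯ t d)   = ty-⪯ (necessitation t) (⪯-● d)
necessitation (ty-ƛ t) with ⊢-wf (ty-ƛ t)
... | _ , v , w            = ty-⪯ (ty-ƛ (necessitation t)) (⪯-≃ (≃-sym (≃-dist v w)))
necessitation (ty-· {Γ} {Γ₁} {Γ₂} t s u) with proj₂ (⊢-wf t)
... | v , w                =
  ty-· (ty-⪯ (necessitation t) (⪯-≃ (≃-dist v w))) (necessitation s) (CtxUnion-● Γ₁ Γ₂ Γ u)

-- Renaming, narrowing and substitution in typing derivations

CtxRen : (ℕ → ℕ) → Ctx → Ctx → Set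
CtxRen ρ Γ Δ = ∀ n {A} → lookupC Γ n ≡ just A → ∃[ B ] lookupC Δ (ρ n) ≡ just B × B ⪯ A

CtxRen-ext : ∀ {ρ A B} Γ Δ → B ⪯ A → CtxRen ρ Γ Δ → CtxRen (ext ρ) (just A ∷ Γ) (just B ∷ Δ)
CtxRen-ext Γ Δ d r zero    refl = _ , refl , d
CtxRen-ext Γ Δ d r (suc n) e    = r n e

CtxRen-● : ∀ {ρ} Γ Δ → CtxRen ρ Γ Δ → CtxRen ρ (●C Γ) (●C Δ)
CtxRen-● {ρ} Γ Δ r n e with lookup-●C⁻ Γ n e
... | _ , e′ , refl with r n e′
...   | B , f , d = ● B , lookup-●C⁺ Δ (ρ n) f , ⪯-● d

-- Since `CtxRen` admits smaller types and further entries in `Δ`, one induction covers weakening,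
-- shifting under binders and narrowing.
⊢-ren : ∀ {ρ Γ Δ M A} → CtxRen ρ Γ Δ → WFC Δ → Γ ⊢ M ∶ A → Δ ⊢ renTm ρ M ∶ A
⊢-ren r w (ty-var {x = x} _ e) with r x e
... | _ , f , d = ty-⪯ (ty-var w f) d
⊢-ren {Γ = Γ} {Δ} r w (ty-● t) = ty-● (⊢-ren (CtxRen-● Γ Δ r) (WFC-●⁺ Δ w) t)
⊢-ren r w (ty-⊤ _)   = ty-⊤ w
⊢-ren r w (ty-⪯ t d) = ty-⪯ (⊢-ren r w t) d
⊢-ren {Γ = Γ} {Δ} r w (ty-ƛ t) with proj₁ (⊢-wf t) zero _ refl
... | v = ty-ƛ (⊢-ren (CtxRen-ext Γ Δ (⪯-refl Valid-[] v) r) (WFC-∷ v w) t)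
⊢-ren {Δ = Δ} r w (ty-· t s u) =
  -- Both premises are typed in all of `Δ`, which is its own union.
  ty-· {Γ₁ = Δ} {Δ} (⊢-ren (λ n e → r n (UnionAt-left (u n) e)) w t)
       (⊢-ren (λ n e → r n (UnionAt-right (u n) e)) w s) (CtxUnion-self Δ)

renTm-id : ∀ {ρ} → ρ ≗ id → renTm ρ ≗ id
renTm-id e (var n) = cong var (e n)
renTm-id {ρ} e (ƛ M) = cong ƛ (renTm-id ext-id M)
  where
  ext-id : ext ρ ≗ id
  ext-id zero    = refl
  ext-id (suc n) = cong suc (e n)
renTm-id e (M · N) = cong₂ _·_ (renTm-id e M) (renTm-id e N)

narrowing : ∀ {Γ Δ M A} → CtxRen id Γ Δ → WFC Δ → Γ ⊢ M ∶ A → Δ ⊢ M ∶ A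
narrowing {Δ = Δ} {M} {A} r w t =
  subst (Δ ⊢_∶ A) (renTm-id (λ _ → refl) M) (⊢-ren r w t)

CtxSub : (ℕ → Tm) → Ctx → Ctx → Set
CtxSub σ Γ Δ = ∀ n {A} → lookupC Γ n ≡ just A → Δ ⊢ σ n ∶ A

⊢-sub : ∀ {σ Γ Δ M A} → CtxSub σ Γ Δ → WFC Δ → Γ ⊢ M ∶ A → Δ ⊢ subTm σ M ∶ A
⊢-sub s w (ty-var {x = x} _ e) = s x e
⊢-sub {σ} {Γ} {Δ} s w (ty-● t) = ty-● (⊢-sub s● (WFC-●⁺ Δ w) t)
  where
  s● : CtxSub σ (●C Γ) (●C Δ)
  s● n e with lookup-●C⁻ Γ n e
  -- The premise of `ty-●` lives in the delayed context, so the inserted terms have to be delayed as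
  -- well.
  ... | _ , e′ , refl = necessitation (s n e′)
⊢-sub s w (ty-⊤ _)     = ty-⊤ w
⊢-sub s w (ty-⪯ t d)   = ty-⪯ (⊢-sub s w t) d
⊢-sub {σ} {Γ} {Δ} s w (ty-ƛ {A = A} t) = ty-ƛ (⊢-sub s′ w′ t)
  where
  w′ : WFC (just A ∷ Δ)
  w′ = WFC-∷ (proj₁ (⊢-wf t) zero _ refl) w
  s′ : CtxSub (extsTm σ) (just A ∷ Γ) (just A ∷ Δ)
  s′ zero    refl = ty-var w′ refl
  s′ (suc n) e    = ⊢-ren (λ m f → _ , f , ⪯-refl Valid-[] (w m _ f)) w′ (s n e)
⊢-sub {Δ = Δ} s w (ty-· t r u) =
  ty-· {Γ₁ = Δ} {Δ} (⊢-sub (λ n e → s n (UnionAt-left (u n) e)) w t)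
       (⊢-sub (λ n e → s n (UnionAt-right (u n) e)) w r) (CtxUnion-self Δ)

-- Generation for abstractions

●C^ : ℕ → Ctx → Ctx
●C^ zero    Γ = Γ
●C^ (suc k) Γ = ●C (●C^ k Γ)

necessitation^ : ∀ {Γ M A} k → Γ ⊢ M ∶ A → ●C^ k Γ ⊢ M ∶ ●^ k A
necessitation^ zero    t = t
necessitation^ (suc k) t = necessitation (necessitation^ k t)

●C^-∷ : ∀ k A Γ → ●C^ k (just A ∷ Γ) ≡ just (●^ k A) ∷ ●C^ k Γ
●C^-∷ zero    A Γ = refl
●C^-∷ (suc k) A Γ = cong ●C (●C^-∷ k A Γ)

⪯-delay : ∀ {γ A} k → Valid γ → WF A → γ ⊢ A ⪯ ●^ k A
⪯-delay zero    v w = ⪯-refl v w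
⪯-delay (suc k) v w = ⪯-trans′ (⪯-delay k v w) (⪯-●ʳ v (proj₂ (⪯-wf (⪯-delay k v w))))

lookup-●C^⁻ : ∀ k Γ n {A} → lookupC (●C^ k Γ) n ≡ just A →
              ∃[ B ] lookupC Γ n ≡ just B × A ≡ ●^ k B
lookup-●C^⁻ zero    Γ n e = _ , e , refl
lookup-●C^⁻ (suc k) Γ n e with lookup-●C⁻ (●C^ k Γ) n e
... | _ , e′ , refl with lookup-●C^⁻ k Γ n e′
...   | B , f , refl = B , f , refl

-- By `A ⪯ ●^ k A`, a derivation in the delayed context can be brought back to `Γ`.
CtxRen-delay : ∀ k Γ → WFC Γ → CtxRen id (●C^ k Γ) Γ
CtxRen-delay k Γ w n e with lookup-●C^⁻ k Γ n e
... | B , f , refl = B , f , ⪯-delay k Valid-[] (w n B f)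

Abstraction : Ctx → Tm → Ty → Set
Abstraction Γ M C =
  tailOf C ≡ nothing ⊎ (∃[ A ] ∃[ B ] Head C A B × (just A ∷ Γ ⊢ M ∶ B))

-- The type `C` is arbitrary because `ty-●` and `ty-⪯` pass through types that are arrows only after
-- unfolding.
ƛ-generation : ∀ {Γ M C} → Γ ⊢ ƛ M ∶ C → Abstraction Γ M C
ƛ-generation (ty-● {A = C} t) with ƛ-generation t
... | inj₁ e = inj₁ (map-nothing⁻¹ (tailOf C) e)
-- The bound variable is delayed together with the context, so `ty-●` applies to the body.
... | inj₂ (_ , _ , head-● h , t′) = inj₂ (_ , _ , h , ty-● t′)
ƛ-generation (ty-⊤ _) = inj₁ refl
ƛ-generation {Γ} {M} (ty-⪯ t d) with ƛ-generation t
... | inj₁ e = inj₁ (⪯-tail-⊤ d e)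
... | inj₂ (A , B , h , t′) with ⪯-head d h
...   | inj₁ e = inj₁ e
...   | inj₂ (A′ , B′ , k , h′ , p , q) = inj₂ (_ , _ , h′ , ty-⪯ (narrowing r w delayed) q)
  where
  delayed : just (●^ k A) ∷ ●C^ k Γ ⊢ M ∶ ●^ k B
  delayed = subst (_⊢ M ∶ ●^ k B) (●C^-∷ k A Γ) (necessitation^ k t′)
  w : WFC (just A′ ∷ Γ)
  w = WFC-∷ (proj₁ (⪯-wf p)) (proj₁ (⊢-wf t))
  -- The new entry uses contravariance, `A′ ⪯ ●^ k A`; the old ones use the delay of `Γ`.
  r : CtxRen id (just (●^ k A) ∷ ●C^ k Γ) (just A′ ∷ Γ)
  r zero    refl = A′ , refl , p
  r (suc n) e    = CtxRen-delay k Γ (proj₁ (⊢-wf t)) n e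
ƛ-generation (ty-ƛ t) = inj₂ (_ , _ , head-⇒ , t)

ƛ-inversion : ∀ {Γ M A B} → Γ ⊢ ƛ M ∶ A ⇒ B → just A ∷ Γ ⊢ M ∶ B
ƛ-inversion t with ƛ-generation t
... | inj₂ (_ , _ , head-⇒ , t′) = t′
... | inj₁ e with ⊢-wf t
-- Here `B` equals ⊤, which types every body.
...   | w , wA , wB = ty-⪯ (ty-⊤ (WFC-∷ wA w)) (⪯-≃ (≃-sym (tail-nothing⇒⊤ wB e)))

β-typing : ∀ {Γ Γ₁ Γ₂ M N A B} → Γ₁ ⊢ ƛ M ∶ A ⇒ B → Γ₂ ⊢ N ∶ A → CtxUnion Γ₁ Γ₂ Γ →
           Γ ⊢ M [ N ] ∶ B
β-typing {Γ} {Γ₁} {Γ₂} {N = N} {A} t s u = ⊢-sub σ w (ƛ-inversion t)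
  where
  w : WFC Γ
  w = proj₁ (⊢-wf (ty-· {Γ} t s u))
  σ : CtxSub (sub0Tm N) (just A ∷ Γ₁) Γ
  σ zero    refl = narrowing r w s
    where
    r : CtxRen id Γ₂ Γ
    r n e with UnionAt-right (u n) e
    ... | f = _ , f , ⪯-refl Valid-[] (w n _ f)
  σ (suc n) e = ty-var w (UnionAt-left (u n) e)

-- Induction on the typing derivation: `ty-●`, `ty-⊤` and `ty-⪯` fit any term, and the remaining
-- rules follow the shape of the reduction.
theorem7p8 : ∀ {Γ : Ctx} {M L : Tm} {A : Ty} → Γ ⊢ M ∶ A → M →β L → Γ ⊢ L ∶ A
theorem7p8 (ty-● t)     r        = ty-● (theorem7p8 t r)
theorem7p8 (ty-⊤ w)     r        = ty-⊤ w
theorem7p8 (ty-⪯ t d)   r        = ty-⪯ (theorem7p8 t r) d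
theorem7p8 (ty-ƛ t)     (ξ-ƛ r)  = ty-ƛ (theorem7p8 t r)
theorem7p8 (ty-· t s u) β        = β-typing t s u
theorem7p8 (ty-· t s u) (ξ-·ₗ r) = ty-· (theorem7p8 t r) s u
theorem7p8 (ty-· t s u) (ξ-·ᵣ r) = ty-· t (theorem7p8 s r) u
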